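{- Let $P$ be a finite poset with a layer structure $(\epsilon,\lambda)$ satisfying property (M). Let $\mu$ be the Möbius function of $P$, $\mu^+$ that of $P^+$ (with the induced order) and $\widehat\mu$ that of the double $\mathcal{D}_P$. Then for all $x_0,x_1\in P$ and $\epsilon_0,\epsilon_1\in\{\pm1\}$, \[ \widehat\mu\bigl((x_0,\epsilon_0),(x_1,\epsilon_1)\bigr)=\begin{cases}\mu(x_0,x_1) & \text{if } \epsilon_0=\epsilon_1,\\ -\mu^+(x_0,\lambda(x_1)) & \text{if } \epsilon_0<\epsilon_1,\ x_0\in P^+,\ x_1\in P^-,\\ 0 & \text{otherwise.}\end{cases} \]
   Context: A layer structure on a poset $P$ is a pair $(\epsilon,\lambda)$ where $\epsilon:P\to\{ -1,1\}$ is increasing, $P^\pm:=\epsilon^{ -1}(\pm1)$, and $\lambda:P^-\to P^+$ is a poset isomorphism with $x<\lambda(x)$ for all $x\in P^-$; $\delta=\lambda^{ -1}$. Property (M): for every $x\in P$ the sets $\{p\in P^+:p\ge x\}$ and $\{p\in P^-:p\le x\}$ are nonempty and have a minimum and a maximum respectively. The double $\mathcal{D}_P$ is the set $P\times\{ -1,1\}$ with the order: $(x_0,\epsilon_0)\preceq(x_1,\epsilon_1)$ iff either $\epsilon_0=\epsilon_1$ and $x_0\le x_1$, or $\epsilon_0=-1,\epsilon_1=1$ and there is $z\in P^+$ with $x_0\le z$ and $\delta(z)\le x_1$. The Möbius function of a finite poset $R$ satisfies $\mu_R(x,x)=1$, $\mu_R(x,y)=0$ unless $x\le y$, $\sum_{x\le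 z\le y}\mu_R(x,z)=0$ for $x<y$. -}

module Defs where

open import Level using (0ℓ)
open import Data.Nat using (ℕ)
open import Data.Fin using (Fin)
open import Data.Integer using (ℤ; _+_; -_; 0ℤ; 1ℤ)
open import Data.Sign using (Sign)
import Data.Sign as S
import Data.Sign.Properties as SP
open import Data.List using (List; []; _∷_; _++_; map; filter; allFin)
open import Data.List.Membership.Propositional using (_∈_)
open import Data.Product using (_×_; _,_; Σ; ∃)
open import Data.Sum using (_⊎_)
open import Relation.Nullary using (¬_)
open import Relation.Binary.PropositionalEquality using (_≡_; _≢_)
open import Relation.Binary.Structures using (IsPartialOrder)

-- Relational finite sum: SumOver Q f L s  means  s = Σ_{z ∈ L, Q z} f z
-- (each element of L is either kept, with a proof of Q, or skipped,
-- with a proof of ¬ Q; so s is uniquely determined).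
data SumOver {A : Set} (Q : A → Set) (f : A → ℤ) : List A → ℤ → Set where
  nil  : SumOver Q f [] 0ℤ
  keep : ∀ {x xs s} → Q x → SumOver Q f xs s → SumOver Q f (x ∷ xs) (f x + s)
  skip : ∀ {x xs s} → ¬ Q x → SumOver Q f xs s → SumOver Q f (x ∷ xs) s

-- m is the Möbius function of the finite poset whose elements are the
-- (duplicate-free) list L, ordered by _≤_ :
--   m(x,x) = 1,  m(x,y) = 0 unless x ≤ y,
--   Σ_{x ≤ z ≤ y} m(x,z) = 0  for x < y.
IsMobius : {A : Set} → List A → (A → A → Set) → (A → A → ℤ) → Set
IsMobius {A} L _≤_ m =
  (∀ {x} → x ∈ L → m x x ≡ 1ℤ) ×
  (∀ {x y} → x ∈ L → y ∈ L → ¬ (x ≤ y) → m x y ≡ 0ℤ) ×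
  (∀ {x y} → x ∈ L → y ∈ L → x ≤ y → x ≢ y →
     SumOver (λ z → (x ≤ z) × (z ≤ y)) (m x) L 0ℤ)

-- A finite poset P with carrier Fin n and order _≤_.
IsFinPoset : (n : ℕ) → (Fin n → Fin n → Set) → Set
IsFinPoset n _≤_ = IsPartialOrder {A = Fin n} _≡_ _≤_

-- Layer structure (ε, λ) on P, with δ = λ⁻¹.  Sign.- ↔ -1, Sign.+ ↔ +1.
-- λ and δ are given as functions on all of Fin n; only their values on
-- P⁻ (for λ) resp. P⁺ (for δ) matter.
record LayerStructure (n : ℕ) (_≤_ : Fin n → Fin n → Set) : Set where
  field
    ε : Fin n → Sign
    λ′ : Fin n → Fin n
    δ : Fin n → Fin n
    -- ε increasing (for -1 < +1)
    ε-mono : ∀ {x y} → x ≤ y → ε x ≡ S.+ → ε y ≡ S.+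
    -- λ : P⁻ → P⁺, δ : P⁺ → P⁻ mutually inverse
    λ-into : ∀ x → ε x ≡ S.- → ε (λ′ x) ≡ S.+
    δ-into : ∀ z → ε z ≡ S.+ → ε (δ z) ≡ S.-
    δλ : ∀ x → ε x ≡ S.- → δ (λ′ x) ≡ x
    λδ : ∀ z → ε z ≡ S.+ → λ′ (δ z) ≡ z
    -- λ is an order isomorphism P⁻ → P⁺ (induced orders)
    λ-mono : ∀ x y → ε x ≡ S.- → ε y ≡ S.- → x ≤ y → λ′ x ≤ λ′ y
    λ-refl : ∀ x y → ε x ≡ S.- → ε y ≡ S.- → λ′ x ≤ λ′ y → x ≤ y
    -- x < λ(x)
    λ-above : ∀ x → ε x ≡ S.- → (x ≤ λ′ x) × (x ≢ λ′ x)

module _ {n : ℕ} {_≤_ : Fin n → Fin n → Set} (L : LayerStructure n _≤_) where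
  open LayerStructure L

  -- Property (M)
  PropertyM : Set
  PropertyM = ∀ x →
    (Σ (Fin n) λ p → (ε p ≡ S.+) × (x ≤ p) ×
        (∀ q → ε q ≡ S.+ → x ≤ q → p ≤ q)) ×
    (Σ (Fin n) λ p → (ε p ≡ S.-) × (p ≤ x) ×
        (∀ q → ε q ≡ S.- → q ≤ x → q ≤ p))

  -- Order of the double 𝒟_P on Fin n × Sign
  _⪯_ : Fin n × Sign → Fin n × Sign → Set
  (x₀ , e₀) ⪯ (x₁ , e₁) =
    ((e₀ ≡ e₁) × (x₀ ≤ x₁)) ⊎
    ((e₀ ≡ S.-) × (e₁ ≡ S.+) ×
      (Σ (Fin n) λ z → (ε z ≡ S.+) × (x₀ ≤ z) × (δ z ≤ x₁)))

  -- elements of P⁺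
  plusElems : List (Fin n)
  plusElems = filter (λ z → ε z SP.≟ S.+) (allFin n)

-- elements of P and of 𝒟_P
elems : (n : ℕ) → List (Fin n)
elems n = allFin n

doubleElems : (n : ℕ) → List (Fin n × Sign)
doubleElems n = map (λ x → (x , S.-)) (allFin n) ++ map (λ x → (x , S.+)) (allFin n)

module Submission where

-- The Möbius function of a finite poset is uniquely determined by its
-- defining recursion.  So it suffices to exhibit the right-hand side of the
-- formula as a function C on the double 𝒟_P and to check that C satisfies
-- that recursion; then μ̂ = C and the three cases can be read off from C.
--
--   1. Restricted sums Σ_{z ∈ L, Q z} f z over lists, and their relation to
--      the relational sums SumOver used in the definition of IsMobius.
--   2. For a decidable partial order on a duplicate-free list: interval sums
--      of a Möbius function are Kronecker deltas, and the Möbius function is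
--      unique (well-founded induction along the strict order).
--   3. Order theory of 𝒟_P: it is well founded, and by property (M)
--      (z,-) ⪯ (y,+) holds iff z ≤ top y, where top y = λ(max P⁻ below y).
--      The layers of P are exchanged by the involution λ ∪ δ.
--   4. C is a Möbius function of 𝒟_P.  In the mixed case the interval sum
--      from (x,-) to (y,+) is [x = top y] - [x = top y]: the lower layer is
--      an interval sum of μ, the upper one (reindexed by λ) one of μ⁺.
--   5. Step 4 needs ≤ decidable.  The goal is an equation in ℤ, hence
--      stable under double negation, and a relation on a finite set is
--      decidable under double negation, which finishes the proof.

open import Defs
open import Algebra.Properties.CommutativeSemigroup as CommSemigroup using ()
import Algebra.Properties.CommutativeMonoid.Sum as FinSum
open import Data.Bool using (if_then_else_)
open import Data.Fin using (Fin; zero; suc)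
import Data.Fin.Properties as FinP
open import Data.Fin.Induction using (po-wellFounded)
open import Data.Fin.Permutation using (permutation)
open import Data.Integer using (ℤ; _+_; _-_; -_; 0ℤ; 1ℤ) renaming (_≟_ to _ℤ≟_)
import Data.Integer.Properties as ℤP
open import Data.List using (List; []; _∷_; _++_; map; filter; allFin; tabulate)
open import Data.List.Membership.Propositional using (_∈_)
open import Data.List.Membership.Propositional.Properties
  using (∈-allFin; ∈-filter⁺; ∈-map⁺; ∈-map⁻; ∈-++⁺ˡ; ∈-++⁺ʳ)
open import Data.List.Relation.Binary.Disjoint.Propositional using (Disjoint)
import Data.List.Relation.Unary.All as All
open import Data.List.Relation.Unary.Any using (here; there)
open import Data.List.Relation.Unary.AllPairs using (_∷_)
open import Data.List.Relation.Unary.Unique.Propositional using (Unique)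
import Data.List.Relation.Unary.Unique.Propositional.Properties as UniqueP
open import Data.Nat using (ℕ; zero; suc)
open import Data.Product using (_×_; _,_; proj₁; proj₂; swap)
open import Data.Product.Relation.Binary.Lex.Strict using (×-Lex; ×-wellFounded)
open import Data.Sign using (Sign)
import Data.Sign as S
import Data.Sign.Properties as SP
open import Data.Sum using (_⊎_; inj₁; inj₂)
open import Function using (_∘_; id)
open import Induction.WellFounded using (WellFounded; Acc; acc; module Subrelation)
import Relation.Binary.Construct.On as On
import Relation.Binary.Construct.NonStrictToStrict as ToStrict
import Data.Product.Properties as PP
import Relation.Binary.Definitions as B
open import Relation.Binary.PropositionalEquality
open import Relation.Binary.Structures using (IsPartialOrder)
open import Relation.Nullary using (¬_; yes; no; does; contradiction)
open import Relation.Nullary.Decidable using (_×-dec_; _⊎-dec_; decidable-stable; ¬¬-excluded-middle)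
open import Relation.Unary using (Decidable)

open ≡-Reasoning

-- 1. Restricted finite sums

-- Σ_{z ∈ L} f z.
sumL : {A : Set} → (A → ℤ) → List A → ℤ
sumL f []       = 0ℤ
sumL f (x ∷ xs) = f x + sumL f xs

-- f restricted to a decidable predicate Q (zero outside Q), and the
-- Kronecker delta [x = y].  Both are opaque: they are used only through the
-- lemmas below, which keeps unification from unfolding them.
opaque
  restrict : {A : Set} {Q : A → Set} → Decidable Q → (A → ℤ) → A → ℤ
  restrict Q? f z = if does (Q? z) then f z else 0ℤ

  restrict-yes : {A : Set} {Q : A → Set} (Q? : Decidable Q) (f : A → ℤ) {z : A} →
    Q z → restrict Q? f z ≡ f z
  restrict-yes Q? f {z} q with Q? z
  ... | yes _ = refl
  ... | no ¬q = contradiction q ¬q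

  restrict-zero : {A : Set} {Q : A → Set} (Q? : Decidable Q) (f : A → ℤ) {z : A} →
    (Q z → f z ≡ 0ℤ) → restrict Q? f z ≡ 0ℤ
  restrict-zero Q? f {z} f≡0 with Q? z
  ... | yes q = f≡0 q
  ... | no _  = refl

  restrict-neg : {A : Set} {Q : A → Set} (Q? : Decidable Q) (f : A → ℤ) (z : A) →
    restrict Q? (λ w → - f w) z ≡ - restrict Q? f z
  restrict-neg Q? f z with Q? z
  ... | yes _ = refl
  ... | no _  = refl

  -- Restrictions agree at a and b if the predicates are equivalent there
  -- and the functions agree whenever the predicate holds.
  restrict-cong : {A B : Set} {Q : A → Set} {R : B → Set}
    (Q? : Decidable Q) (R? : Decidable R) {f : A → ℤ} {g : B → ℤ} {a : A} {b : B} →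
    (Q a → R b) → (R b → Q a) → (Q a → f a ≡ g b) →
    restrict Q? f a ≡ restrict R? g b
  restrict-cong Q? R? {a = a} {b} to from f≡g with Q? a | R? b
  ... | yes q | yes _  = f≡g q
  ... | yes q | no ¬r  = contradiction (to q) ¬r
  ... | no ¬q | yes r  = contradiction (from r) ¬q
  ... | no _  | no _   = refl

  kronecker : {A : Set} → B.DecidableEquality A → A → A → ℤ
  kronecker _≟_ x y = if does (x ≟ y) then 1ℤ else 0ℤ

  kronecker-refl : {A : Set} (_≟_ : B.DecidableEquality A) (x : A) → kronecker _≟_ x x ≡ 1ℤ
  kronecker-refl _≟_ x with x ≟ x
  ... | yes _  = refl
  ... | no x≢x = contradiction refl x≢x

  kronecker-≢ : {A : Set} (_≟_ : B.DecidableEquality A) {x y : A} → x ≢ y → kronecker _≟_ x y ≡ 0ℤ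
  kronecker-≢ _≟_ {x} {y} x≢y with x ≟ y
  ... | yes x≡y = contradiction x≡y x≢y
  ... | no _    = refl

restrict-no : {A : Set} {Q : A → Set} (Q? : Decidable Q) (f : A → ℤ) {z : A} →
  ¬ Q z → restrict Q? f z ≡ 0ℤ
restrict-no Q? f ¬q = restrict-zero Q? f (λ q → contradiction q ¬q)

module _ {A : Set} where

  sumL-cong : ∀ {f g : A → ℤ} → (∀ z → f z ≡ g z) → ∀ L → sumL f L ≡ sumL g L
  sumL-cong f≗g []       = refl
  sumL-cong f≗g (x ∷ xs) = cong₂ _+_ (f≗g x) (sumL-cong f≗g xs)

  sumL-++ : ∀ (f : A → ℤ) xs ys → sumL f (xs ++ ys) ≡ sumL f xs + sumL f ys
  sumL-++ f []       ys = sym (ℤP.+-identityˡ _)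
  sumL-++ f (x ∷ xs) ys = trans (cong (f x +_) (sumL-++ f xs ys)) (sym (ℤP.+-assoc (f x) _ _))

  sumL-map : ∀ {C : Set} (f : A → ℤ) (h : C → A) xs → sumL f (map h xs) ≡ sumL (f ∘ h) xs
  sumL-map f h []       = refl
  sumL-map f h (x ∷ xs) = cong (f (h x) +_) (sumL-map f h xs)

  -- Summing over a filtered list is summing the restricted function.
  sumL-filter : ∀ {Q : A → Set} (Q? : Decidable Q) (f : A → ℤ) xs →
    sumL f (filter Q? xs) ≡ sumL (restrict Q? f) xs
  sumL-filter Q? f []       = refl
  sumL-filter Q? f (x ∷ xs) with Q? x
  ... | yes q = cong₂ _+_ (sym (restrict-yes Q? f q)) (sumL-filter Q? f xs)
  ... | no ¬q = begin
    sumL f (filter Q? xs)                     ≡⟨ sumL-filter Q? f xs ⟩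
    sumL (restrict Q? f) xs                   ≡⟨ ℤP.+-identityˡ _ ⟨
    0ℤ + sumL (restrict Q? f) xs              ≡⟨ cong (_+ _) (restrict-no Q? f ¬q) ⟨
    restrict Q? f x + sumL (restrict Q? f) xs ∎

  sumL-+ : ∀ (f g : A → ℤ) L → sumL (λ z → f z + g z) L ≡ sumL f L + sumL g L
  sumL-+ f g []       = refl
  sumL-+ f g (x ∷ xs) = trans (cong (f x + g x +_) (sumL-+ f g xs))
    (CommSemigroup.interchange ℤP.+-commutativeSemigroup (f x) (g x) _ _)

  sumL-neg : ∀ (f : A → ℤ) L → sumL (λ z → - f z) L ≡ - sumL f L
  sumL-neg f []       = refl
  sumL-neg f (x ∷ xs) = trans (cong (- f x +_) (sumL-neg f xs)) (sym (ℤP.neg-distrib-+ (f x) _))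

  sumL-sub : ∀ (f g : A → ℤ) L → sumL (λ z → f z - g z) L ≡ sumL f L - sumL g L
  sumL-sub f g L = trans (sumL-+ f (λ z → - g z) L) (cong (sumL f L +_) (sumL-neg g L))

  sumL-vanish : ∀ {f : A → ℤ} L → (∀ {z} → z ∈ L → f z ≡ 0ℤ) → sumL f L ≡ 0ℤ
  sumL-vanish []       f≡0 = refl
  sumL-vanish (x ∷ xs) f≡0 = cong₂ _+_ (f≡0 (here refl)) (sumL-vanish xs (f≡0 ∘ there))

  -- On a duplicate-free list, a function vanishing on L outside y sums to f y.
  sumL-point : ∀ {f : A → ℤ} {L y} → Unique L → y ∈ L →
    (∀ {z} → z ∈ L → z ≢ y → f z ≡ 0ℤ) → sumL f L ≡ f y
  sumL-point {f} (x∉xs ∷ _) (here refl) f≡0 = trans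
    (cong (f _ +_) (sumL-vanish _ λ z∈xs → f≡0 (there z∈xs) (All.lookup x∉xs z∈xs ∘ sym)))
    (ℤP.+-identityʳ _)
  sumL-point {f} (x∉xs ∷ u) (there y∈xs) f≡0 = trans
    (cong₂ _+_ (f≡0 (here refl) (λ x≡y → All.lookup x∉xs y∈xs x≡y)) (sumL-point u y∈xs (f≡0 ∘ there)))
    (ℤP.+-identityˡ _)

-- Computing a relational sum SumOver by a restricted sum, and conversely.
module _ {A : Set} {Q : A → Set} (Q? : Decidable Q) {f : A → ℤ} where

  SumOver⇒sumL : ∀ {L s} → SumOver Q f L s → s ≡ sumL (restrict Q? f) L
  SumOver⇒sumL nil = refl
  SumOver⇒sumL (keep q S) = cong₂ _+_ (sym (restrict-yes Q? f q)) (SumOver⇒sumL S)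
  SumOver⇒sumL (skip {x} {xs} {s} ¬q S) = begin
    s                                         ≡⟨ SumOver⇒sumL S ⟩
    sumL (restrict Q? f) xs                   ≡⟨ ℤP.+-identityˡ _ ⟨
    0ℤ + sumL (restrict Q? f) xs              ≡⟨ cong (_+ _) (restrict-no Q? f ¬q) ⟨
    restrict Q? f x + sumL (restrict Q? f) xs ∎

  sumL⇒SumOver : ∀ L → SumOver Q f L (sumL (restrict Q? f) L)
  sumL⇒SumOver []       = nil
  sumL⇒SumOver (x ∷ xs) with Q? x
  ... | yes q = subst (SumOver Q f (x ∷ xs)) (cong (_+ _) (sym (restrict-yes Q? f q)))
                  (keep q (sumL⇒SumOver xs))
  ... | no ¬q = subst (SumOver Q f (x ∷ xs)) (trans (sym (ℤP.+-identityˡ _)) (cong (_+ _) (sym (restrict-no Q? f ¬q))))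
                  (skip ¬q (sumL⇒SumOver xs))

module _ {n : ℕ} where

  private module Fin∑ = FinSum ℤP.+-0-commutativeMonoid

  sumL-allFin : ∀ (f : Fin n → ℤ) → sumL f (allFin n) ≡ Fin∑.sum f
  sumL-allFin f = go id
    where
    go : ∀ {m} (h : Fin m → Fin n) → sumL f (tabulate h) ≡ Fin∑.sum (f ∘ h)
    go {zero}  h = refl
    go {suc m} h = cong (f (h zero) +_) (go (h ∘ suc))

  -- A sum over Fin n is invariant under reindexing by an involution.
  sumL-involution : ∀ (f : Fin n → ℤ) (σ : Fin n → Fin n) → (∀ z → σ (σ z) ≡ z) →
    sumL (f ∘ σ) (allFin n) ≡ sumL f (allFin n)
  sumL-involution f σ σσ = begin
    sumL (f ∘ σ) (allFin n) ≡⟨ sumL-allFin (f ∘ σ) ⟩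
    Fin∑.sum (f ∘ σ)           ≡⟨ Fin∑.sum-permute f (permutation σ σ σσ σσ) ⟨
    Fin∑.sum f                 ≡⟨ sumL-allFin f ⟨
    sumL f (allFin n)       ∎

-- 2. Möbius functions of a decidable partial order on a duplicate-free list

module MobiusFunction {A : Set} (_≟_ : B.DecidableEquality A)
  {_≤_ : A → A → Set} (_≤?_ : B.Decidable _≤_)
  (≤-refl : ∀ {x} → x ≤ x) {L : List A} (L-unique : Unique L) where

  Interval : A → A → A → Set
  Interval x y z = (x ≤ z) × (z ≤ y)

  interval? : ∀ x y → Decidable (Interval x y)
  interval? x y z = (x ≤? z) ×-dec (z ≤? y)

  -- Σ_{z ∈ L, x ≤ z ≤ y} f z
  intervalSum : (A → ℤ) → A → A → ℤ
  intervalSum f x y = sumL (restrict (interval? x y) f) L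

  -- Σ_{x ≤ z ≤ y} m(x,z) = [x = y]: the defining recursion for x < y;
  -- for x = y antisymmetry leaves only the term m(x,x) = 1.
  interval-sum : (∀ {x y} → x ≤ y → y ≤ x → x ≡ y) →
    ∀ {m x y} → IsMobius L _≤_ m → x ∈ L → y ∈ L → x ≤ y →
    intervalSum (m x) x y ≡ kronecker _≟_ x y
  interval-sum ≤-antisym {m} {x} {y} (m-diag , _ , m-sum) x∈L y∈L x≤y with x ≟ y
  ... | no x≢y   = trans (sym (SumOver⇒sumL (interval? x y) (m-sum x∈L y∈L x≤y x≢y)))
                          (sym (kronecker-≢ _≟_ x≢y))
  ... | yes refl = begin
    intervalSum (m x) x x            ≡⟨ sumL-point L-unique x∈L off-x ⟩
    restrict (interval? x x) (m x) x ≡⟨ restrict-yes (interval? x x) (m x) (≤-refl , ≤-refl) ⟩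
    m x x                            ≡⟨ m-diag x∈L ⟩
    1ℤ                               ≡⟨ kronecker-refl _≟_ x ⟨
    kronecker _≟_ x x                ∎
    where
    off-x : ∀ {z} → z ∈ L → z ≢ x → restrict (interval? x x) (m x) z ≡ 0ℤ
    off-x z∈L z≢x = restrict-zero (interval? x x) (m x)
      (λ (x≤z , z≤x) → contradiction (≤-antisym z≤x x≤z) z≢x)

  -- In [x, y] ∩ L the value at the top y is determined by the interval sum
  -- and the values strictly below y.
  top-determined : ∀ {f g : A → ℤ} {x y} → x ≤ y → y ∈ L →
    (∀ {z} → z ∈ L → Interval x y z → z ≢ y → f z ≡ g z) →
    intervalSum f x y ≡ intervalSum g x y → f y ≡ g y
  top-determined {f} {g} {x} {y} x≤y y∈L agree sums≡ = ℤP.i-j≡0⇒i≡j _ _ (begin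
    f y - g y                             ≡⟨ cong₂ _-_ (restrict-yes I? f x≤y≤y) (restrict-yes I? g x≤y≤y) ⟨
    difference y                          ≡⟨ sumL-point L-unique y∈L off-top ⟨
    sumL difference L                     ≡⟨ sumL-sub (restrict I? f) (restrict I? g) L ⟩
    intervalSum f x y - intervalSum g x y ≡⟨ ℤP.i≡j⇒i-j≡0 sums≡ ⟩
    0ℤ                                    ∎)
    where
    I? : Decidable (Interval x y)
    I? = interval? x y
    x≤y≤y : Interval x y y
    x≤y≤y = x≤y , ≤-refl
    difference : A → ℤ
    difference z = restrict I? f z - restrict I? g z
    off-top : ∀ {z} → z ∈ L → z ≢ y → difference z ≡ 0ℤ
    off-top z∈L z≢y = ℤP.i≡j⇒i-j≡0 (restrict-cong I? I? {f} {g} id id (λ I → agree z∈L I z≢y))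

  -- The strict order, along which the Möbius recursion proceeds.
  _<_ : A → A → Set
  x < y = (x ≤ y) × (x ≢ y)

  -- Uniqueness of the Möbius function, by well-founded induction on y.
  mobius-unique : WellFounded _<_ → ∀ {m m′} → IsMobius L _≤_ m → IsMobius L _≤_ m′ →
    ∀ {x y} → x ∈ L → y ∈ L → m x y ≡ m′ x y
  mobius-unique <-wf {m} {m′} (m-diag , m-zero , m-sum) (m′-diag , m′-zero , m′-sum) {x} x∈L =
    go (<-wf _)
    where
    go : ∀ {y} → Acc _<_ y → y ∈ L → m x y ≡ m′ x y
    go {y} (acc below) y∈L with x ≤? y | x ≟ y
    ... | no x≰y  | _        = trans (m-zero x∈L y∈L x≰y) (sym (m′-zero x∈L y∈L x≰y))
    ... | yes _   | yes refl = trans (m-diag x∈L) (sym (m′-diag x∈L))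
    ... | yes x≤y | no x≢y   = top-determined x≤y y∈L
      (λ z∈L (_ , z≤y) z≢y → go (below (z≤y , z≢y)) z∈L)
      (trans (sym (SumOver⇒sumL (interval? x y) (m-sum x∈L y∈L x≤y x≢y)))
             (SumOver⇒sumL (interval? x y) (m′-sum x∈L y∈L x≤y x≢y)))

-- 3. Order theory of the double 𝒟_P

-- The strict order - < + on signs; 𝒟_P is ordered lexicographically by
-- (sign, element), which makes it well founded.
data _<ˢ_ : Sign → Sign → Set where
  -<+ : S.- <ˢ S.+

<ˢ-wellFounded : WellFounded _<ˢ_
<ˢ-wellFounded _ = acc λ { -<+ → acc λ () }

-- Case analysis on a sign, remembering the case.
sign-cases : ∀ s → (s ≡ S.-) ⊎ (s ≡ S.+)
sign-cases S.- = inj₁ refl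
sign-cases S.+ = inj₂ refl

module Double {n : ℕ} {_≤_ : Fin n → Fin n → Set} (po : IsFinPoset n _≤_)
  (layers : LayerStructure n _≤_) (M : PropertyM layers) where

  open LayerStructure layers
  open IsPartialOrder po using () renaming (refl to ≤-refl; trans to ≤-trans; antisym to ≤-antisym)

  _⊑_ : Fin n × Sign → Fin n × Sign → Set
  _⊑_ = _⪯_ layers

  -- The strict order of 𝒟_P is contained in the lexicographic order on
  -- (sign, element), which is well founded since P is finite.
  _⊏_ : Fin n × Sign → Fin n × Sign → Set
  a ⊏ b = (a ⊑ b) × (a ≢ b)

  ⊏-wellFounded : WellFounded _⊏_
  ⊏-wellFounded = Subrelation.wellFounded ⊏⇒lex
    (On.wellFounded swap (×-wellFounded <ˢ-wellFounded (po-wellFounded po)))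
    where
    ⊏⇒lex : ∀ {a b} → a ⊏ b → ×-Lex _≡_ _<ˢ_ (ToStrict._<_ _≡_ _≤_) (swap a) (swap b)
    ⊏⇒lex {_ , e} (inj₁ (refl , x≤y) , a≢b)   = inj₂ (refl , x≤y , a≢b ∘ cong (_, e))
    ⊏⇒lex         (inj₂ (refl , refl , _) , _) = inj₁ -<+

  -- Within a layer 𝒟_P is a copy of P, and no upper element lies below a
  -- lower one.
  ⊑-same⇒ : ∀ {x y e} → (x , e) ⊑ (y , e) → x ≤ y
  ⊑-same⇒ (inj₁ (_ , x≤y))       = x≤y
  ⊑-same⇒ (inj₂ (refl , () , _))

  ⊑-same⇐ : ∀ {x y e} → x ≤ y → (x , e) ⊑ (y , e)
  ⊑-same⇐ x≤y = inj₁ (refl , x≤y)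

  ⊑-+- : ∀ {x y} → ¬ ((x , S.+) ⊑ (y , S.-))
  ⊑-+- (inj₁ (() , _))
  ⊑-+- (inj₂ (() , _))

  -- P⁻ and P⁺ are disjoint.
  minus≢plus : ∀ {z w} → ε z ≡ S.- → ε w ≡ S.+ → z ≢ w
  minus≢plus εz εw refl = contradiction (trans (sym εz) εw) λ ()

  -- max {p ∈ P⁻ : p ≤ y}, which exists by property (M).
  maxBelow : Fin n → Fin n
  maxBelow y = proj₁ (proj₂ (M y))

  maxBelow-minus : ∀ y → ε (maxBelow y) ≡ S.-
  maxBelow-minus y = proj₁ (proj₂ (proj₂ (M y)))

  maxBelow-≤ : ∀ y → maxBelow y ≤ y
  maxBelow-≤ y = proj₁ (proj₂ (proj₂ (proj₂ (M y))))

  maxBelow-max : ∀ {y q} → ε q ≡ S.- → q ≤ y → q ≤ maxBelow y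
  maxBelow-max {y} {q} = proj₂ (proj₂ (proj₂ (proj₂ (M y)))) q

  -- top y = λ(max P⁻ below y) is the largest z with (z,-) ⊑ (y,+).
  top : Fin n → Fin n
  top y = λ′ (maxBelow y)

  top-plus : ∀ y → ε (top y) ≡ S.+
  top-plus y = λ-into (maxBelow y) (maxBelow-minus y)

  -- For z ∈ P⁻, z ≤ y iff λ z ≤ top y (λ is an order isomorphism).
  λ≤top⇒ : ∀ {z y} → ε z ≡ S.- → z ≤ y → λ′ z ≤ top y
  λ≤top⇒ {z} {y} εz z≤y = λ-mono z (maxBelow y) εz (maxBelow-minus y) (maxBelow-max εz z≤y)

  λ≤top⇐ : ∀ {z y} → ε z ≡ S.- → λ′ z ≤ top y → z ≤ y
  λ≤top⇐ {z} {y} εz λz≤t = ≤-trans (λ-refl z (maxBelow y) εz (maxBelow-minus y) λz≤t) (maxBelow-≤ y)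

  -- (z,-) ⊑ (y,+) iff z ≤ top y: any witness w of (z,-) ⊑ (y,+) has
  -- δ w ≤ max P⁻ below y, hence w ≤ top y.
  mixed⇒ : ∀ {z y} → (z , S.-) ⊑ (y , S.+) → z ≤ top y
  mixed⇒ (inj₁ (() , _))
  mixed⇒ {z} {y} (inj₂ (_ , _ , w , εw , z≤w , δw≤y)) = ≤-trans z≤w
    (subst (_≤ top y) (λδ w εw) (λ≤top⇒ (δ-into w εw) δw≤y))

  mixed⇐ : ∀ {z y} → z ≤ top y → (z , S.-) ⊑ (y , S.+)
  mixed⇐ {z} {y} z≤t = inj₂ (refl , refl , top y , top-plus y , z≤t ,
    subst (_≤ y) (sym (δλ (maxBelow y) (maxBelow-minus y))) (maxBelow-≤ y))

  -- On P⁻, top is λ (z is the largest element of P⁻ below itself).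
  top-minus : ∀ {z} → ε z ≡ S.- → top z ≡ λ′ z
  top-minus {z} εz = cong λ′ (≤-antisym (maxBelow-≤ z) (maxBelow-max εz ≤-refl))

  -- The involution of P exchanging P⁻ and P⁺: λ on P⁻ and δ on P⁺.
  byLayer : Sign → Fin n → Fin n
  byLayer S.- = λ′
  byLayer S.+ = δ

  layerSwap : Fin n → Fin n
  layerSwap z = byLayer (ε z) z

  layerSwap-minus : ∀ {z} → ε z ≡ S.- → layerSwap z ≡ λ′ z
  layerSwap-minus {z} εz = cong (λ s → byLayer s z) εz

  layerSwap-plus : ∀ {z} → ε z ≡ S.+ → layerSwap z ≡ δ z
  layerSwap-plus {z} εz = cong (λ s → byLayer s z) εz

  layerSwap-involutive : ∀ z → layerSwap (layerSwap z) ≡ z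
  layerSwap-involutive z with sign-cases (ε z)
  ... | inj₁ εz = trans (cong layerSwap (layerSwap-minus εz)) (trans (layerSwap-plus (λ-into z εz)) (δλ z εz))
  ... | inj₂ εz = trans (cong layerSwap (layerSwap-plus εz)) (trans (layerSwap-minus (δ-into z εz)) (λδ z εz))

  -- The element lists of P, P⁺ and 𝒟_P are complete and duplicate-free.
  ∈-elems : ∀ x → x ∈ elems n
  ∈-elems = ∈-allFin

  ∈-plusElems : ∀ {x} → ε x ≡ S.+ → x ∈ plusElems layers
  ∈-plusElems {x} εx = ∈-filter⁺ (λ z → ε z SP.≟ S.+) (∈-allFin x) εx

  ∈-doubleElems : ∀ a → a ∈ doubleElems n
  ∈-doubleElems (x , S.-) = ∈-++⁺ˡ (∈-map⁺ (_, S.-) (∈-allFin x))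
  ∈-doubleElems (x , S.+) = ∈-++⁺ʳ (map (_, S.-) (allFin n)) (∈-map⁺ (_, S.+) (∈-allFin x))

  plusElems-unique : Unique (plusElems layers)
  plusElems-unique = UniqueP.filter⁺ (λ z → ε z SP.≟ S.+) (UniqueP.allFin⁺ n)

  doubleElems-unique : Unique (doubleElems n)
  doubleElems-unique = UniqueP.++⁺ (layer-unique S.-) (layer-unique S.+) layers-disjoint
    where
    layer-unique : ∀ e → Unique (map (_, e) (allFin n))
    layer-unique e = UniqueP.map⁺ (cong proj₁) (UniqueP.allFin⁺ n)
    layers-disjoint : Disjoint (map (_, S.-) (allFin n)) (map (_, S.+) (allFin n))
    layers-disjoint (a∈⁻ , a∈⁺) with ∈-map⁻ (_, S.-) a∈⁻ | ∈-map⁻ (_, S.+) a∈⁺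
    ... | _ , _ , refl | _ , _ , ()

  sumL-doubleElems : ∀ (f : Fin n × Sign → ℤ) →
    sumL f (doubleElems n) ≡ sumL (λ z → f (z , S.-)) (allFin n) + sumL (λ z → f (z , S.+)) (allFin n)
  sumL-doubleElems f = trans (sumL-++ f (map (_, S.-) (allFin n)) _)
    (cong₂ _+_ (sumL-map f (_, S.-) (allFin n)) (sumL-map f (_, S.+) (allFin n)))

-- 4. The candidate C is a Möbius function of 𝒟_P

  -- x ∈ P⁺ and y ∈ P⁻: the only case in which μ̂((x,-),(y,+)) can be nonzero.
  Crossing : Fin n → Fin n → Set
  Crossing x y = (ε x ≡ S.+) × (ε y ≡ S.-)

  crossing? : ∀ x → Decidable (Crossing x)
  crossing? x y = (ε x SP.≟ S.+) ×-dec (ε y SP.≟ S.-)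

  -- The right-hand side of the formula.
  module Candidate (μ μ⁺ : Fin n → Fin n → ℤ) where

    C : Fin n × Sign → Fin n × Sign → ℤ
    C (x , S.-) (y , S.-) = μ x y
    C (x , S.+) (y , S.+) = μ x y
    C (x , S.+) (y , S.-) = 0ℤ
    C (x , S.-) (y , S.+) = restrict (crossing? x) (λ w → - μ⁺ x (λ′ w)) y

    C-same : ∀ e x y → C (x , e) (y , e) ≡ μ x y
    C-same S.- x y = refl
    C-same S.+ x y = refl

    C-crossing : ∀ {x y} → Crossing x y → C (x , S.-) (y , S.+) ≡ - μ⁺ x (λ′ y)
    C-crossing {x} = restrict-yes (crossing? x) _

    C-vanish : ∀ {e₀ e₁ x y} → e₀ ≢ e₁ → ¬ ((e₀ ≡ S.-) × (e₁ ≡ S.+) × Crossing x y) →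
      C (x , e₀) (y , e₁) ≡ 0ℤ
    C-vanish {S.-} {S.-} e₀≢e₁ _ = contradiction refl e₀≢e₁
    C-vanish {S.+} {S.+} e₀≢e₁ _ = contradiction refl e₀≢e₁
    C-vanish {S.+} {S.-} _ _ = refl
    C-vanish {S.-} {S.+} {x} _ ¬mixed =
      restrict-zero (crossing? x) _ (λ cr → contradiction (refl , refl , cr) ¬mixed)

  -- The verification of C and μ̂ = C, for decidable ≤.
  module Decided (_≤?_ : B.Decidable _≤_) where

    _⊑?_ : B.Decidable _⊑_
    (x , e₀) ⊑? (y , e₁) = ((e₀ SP.≟ e₁) ×-dec (x ≤? y)) ⊎-dec
      ((e₀ SP.≟ S.-) ×-dec (e₁ SP.≟ S.+) ×-dec
        FinP.any? (λ z → (ε z SP.≟ S.+) ×-dec (x ≤? z) ×-dec (δ z ≤? y)))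

    -- The Möbius-function facts of part 2 for P, P⁺ and 𝒟_P.
    module P  = MobiusFunction FinP._≟_ _≤?_ ≤-refl (UniqueP.allFin⁺ n)
    module P⁺ = MobiusFunction FinP._≟_ _≤?_ ≤-refl plusElems-unique
    module 𝒟  = MobiusFunction (PP.≡-dec FinP._≟_ SP._≟_) _⊑?_ (⊑-same⇐ ≤-refl) doubleElems-unique

    module _ {μ μ⁺ : Fin n → Fin n → ℤ}
      (Mμ : IsMobius (elems n) _≤_ μ) (Mμ⁺ : IsMobius (plusElems layers) _≤_ μ⁺) where

      open Candidate μ μ⁺

      -- The part of the 𝒟_P-interval sum from a to b lying in layer e.
      layerSum : Fin n × Sign → Fin n × Sign → Sign → ℤ
      layerSum a b e = sumL (λ z → restrict (𝒟.interval? a b) (C a) (z , e)) (allFin n)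

      intervalSum-layers : ∀ a b → 𝒟.intervalSum (C a) a b ≡ layerSum a b S.- + layerSum a b S.+
      intervalSum-layers a b = sumL-doubleElems (restrict (𝒟.interval? a b) (C a))

      -- Interval sums of μ over non-degenerate intervals vanish.
      P-interval-zero : ∀ {x y} → x ≤ y → x ≢ y → P.intervalSum (μ x) x y ≡ 0ℤ
      P-interval-zero {x} {y} x≤y x≢y =
        trans (P.interval-sum ≤-antisym Mμ (∈-elems x) (∈-elems y) x≤y) (kronecker-≢ FinP._≟_ x≢y)

      -- The layer e of the 𝒟_P-interval [(x,e), (y,e)] is the P-interval [x, y] ...
      same-layer : ∀ e x y → layerSum (x , e) (y , e) e ≡ P.intervalSum (μ x) x y
      same-layer e x y = sumL-cong (λ z → restrict-cong (𝒟.interval? (x , e) (y , e)) (P.interval? x y)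
        (λ (x⊑z , z⊑y) → ⊑-same⇒ x⊑z , ⊑-same⇒ z⊑y) (λ (x≤z , z≤y) → ⊑-same⇐ x≤z , ⊑-same⇐ z≤y)
        (λ _ → C-same e x z)) (allFin n)

      -- ... and the other layer is empty.
      same-interval-sum : ∀ e {x y} → x ≤ y → x ≢ y → 𝒟.intervalSum (C (x , e)) (x , e) (y , e) ≡ 0ℤ
      same-interval-sum S.- {x} {y} x≤y x≢y = trans (intervalSum-layers (x , S.-) (y , S.-))
        (cong₂ _+_ (trans (same-layer S.- x y) (P-interval-zero x≤y x≢y))
          (sumL-vanish (allFin n) λ _ → restrict-zero (𝒟.interval? _ _) _ (λ (_ , z⊑y) → contradiction z⊑y ⊑-+-)))
      same-interval-sum S.+ {x} {y} x≤y x≢y = trans (intervalSum-layers (x , S.+) (y , S.+))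
        (cong₂ _+_ (sumL-vanish (allFin n) λ _ → restrict-zero (𝒟.interval? _ _) _ (λ (x⊑z , _) → contradiction x⊑z ⊑-+-))
          (trans (same-layer S.+ x y) (P-interval-zero x≤y x≢y)))

      -- The lower layer of [(x,-), (y,+)] is the P-interval [x, top y].
      mixed-lower-layer : ∀ {x y} → (x , S.-) ⊑ (y , S.+) →
        layerSum (x , S.-) (y , S.+) S.- ≡ kronecker FinP._≟_ x (top y)
      mixed-lower-layer {x} {y} x⊑y = trans
        (sumL-cong (λ z → restrict-cong (𝒟.interval? (x , S.-) (y , S.+)) (P.interval? x (top y))
          (λ (x⊑z , z⊑y) → ⊑-same⇒ x⊑z , mixed⇒ z⊑y) (λ (x≤z , z≤t) → ⊑-same⇐ x≤z , mixed⇐ z≤t)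
          (λ _ → refl)) (allFin n))
        (P.interval-sum ≤-antisym Mμ (∈-elems x) (∈-elems (top y)) (mixed⇒ x⊑y))

      -- μ⁺(x, w) on [x, t] ∩ P⁺, extended by zero to P.
      upperSummand : Fin n → Fin n → Fin n → ℤ
      upperSummand x t = restrict (λ w → ε w SP.≟ S.+) (restrict (P⁺.interval? x t) (μ⁺ x))

      -- For x ∈ P⁺, the upper-layer term at z is the P⁺-interval term at λ z,
      -- negated (and vanishes for z ∈ P⁺).
      mixed-upper-term : ∀ {x} y → ε x ≡ S.+ → ∀ z →
        restrict (𝒟.interval? (x , S.-) (y , S.+)) (C (x , S.-)) (z , S.+) ≡
        - upperSummand x (top y) (layerSwap z)
      mixed-upper-term {x} y εx z with sign-cases (ε z)
      ... | inj₁ εz = begin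
        restrict Î (C (x , S.-)) (z , S.+)
          ≡⟨ restrict-cong Î (P⁺.interval? x t) to from (λ _ → C-crossing (εx , εz)) ⟩
        restrict (P⁺.interval? x t) (λ w → - μ⁺ x w) (λ′ z)
          ≡⟨ restrict-neg (P⁺.interval? x t) (μ⁺ x) (λ′ z) ⟩
        - restrict (P⁺.interval? x t) (μ⁺ x) (λ′ z)
          ≡⟨ cong -_ (restrict-yes (λ w → ε w SP.≟ S.+) _ (λ-into z εz)) ⟨
        - upperSummand x t (λ′ z)
          ≡⟨ cong (-_ ∘ upperSummand x t) (layerSwap-minus εz) ⟨
        - upperSummand x t (layerSwap z) ∎
        where
        Î : Decidable (𝒟.Interval (x , S.-) (y , S.+))
        Î = 𝒟.interval? (x , S.-) (y , S.+)
        t : Fin n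
        t = top y
        to : 𝒟.Interval (x , S.-) (y , S.+) (z , S.+) → P⁺.Interval x t (λ′ z)
        to (x⊑z , z⊑y) = subst (x ≤_) (top-minus εz) (mixed⇒ x⊑z) , λ≤top⇒ εz (⊑-same⇒ z⊑y)
        from : P⁺.Interval x t (λ′ z) → 𝒟.Interval (x , S.-) (y , S.+) (z , S.+)
        from (x≤λz , λz≤t) = mixed⇐ (subst (x ≤_) (sym (top-minus εz)) x≤λz) , ⊑-same⇐ (λ≤top⇐ εz λz≤t)
      ... | inj₂ εz = trans
        (restrict-zero (𝒟.interval? _ _) _ λ _ →
          restrict-zero (crossing? x) _ λ (_ , εz≡-) → contradiction refl (minus≢plus εz≡- εz))
        (cong -_ (sym (restrict-zero (λ w → ε w SP.≟ S.+) _ λ εδz →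
          contradiction (sym (layerSwap-plus εz)) (minus≢plus (δ-into z εz) εδz))))

      -- The upper layer of [(x,-), (y,+)] contributes -[x = top y].
      mixed-upper-layer : ∀ {x y} → (x , S.-) ⊑ (y , S.+) →
        layerSum (x , S.-) (y , S.+) S.+ ≡ - kronecker FinP._≟_ x (top y)
      mixed-upper-layer {x} {y} x⊑y with sign-cases (ε x)
      ... | inj₂ εx = begin
        layerSum (x , S.-) (y , S.+) S.+
          ≡⟨ sumL-cong (mixed-upper-term y εx) (allFin n) ⟩
        sumL (λ z → - upperSummand x t (layerSwap z)) (allFin n)
          ≡⟨ sumL-neg (upperSummand x t ∘ layerSwap) (allFin n) ⟩
        - sumL (upperSummand x t ∘ layerSwap) (allFin n)
          ≡⟨ cong -_ (sumL-involution (upperSummand x t) layerSwap layerSwap-involutive) ⟩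
        - sumL (upperSummand x t) (allFin n)
          ≡⟨ cong -_ (sumL-filter (λ w → ε w SP.≟ S.+) _ (allFin n)) ⟨
        - P⁺.intervalSum (μ⁺ x) x t
          ≡⟨ cong -_ (P⁺.interval-sum ≤-antisym Mμ⁺ (∈-plusElems εx) (∈-plusElems (top-plus y)) (mixed⇒ x⊑y)) ⟩
        - kronecker FinP._≟_ x t ∎
        where
        t : Fin n
        t = top y
      ... | inj₁ εx = trans
        (sumL-vanish (allFin n) λ _ → restrict-zero (𝒟.interval? _ _) _ λ _ →
          restrict-zero (crossing? x) _ λ (εx≡+ , _) → contradiction refl (minus≢plus εx εx≡+))
        (cong -_ (sym (kronecker-≢ FinP._≟_ (minus≢plus εx (top-plus y)))))

      -- The two layers cancel: [x = top y] - [x = top y] = 0.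
      mixed-interval-sum : ∀ {x y} → (x , S.-) ⊑ (y , S.+) →
        𝒟.intervalSum (C (x , S.-)) (x , S.-) (y , S.+) ≡ 0ℤ
      mixed-interval-sum {x} {y} x⊑y = begin
        𝒟.intervalSum (C (x , S.-)) (x , S.-) (y , S.+)
          ≡⟨ intervalSum-layers (x , S.-) (y , S.+) ⟩
        layerSum (x , S.-) (y , S.+) S.- + layerSum (x , S.-) (y , S.+) S.+
          ≡⟨ cong₂ _+_ (mixed-lower-layer x⊑y) (mixed-upper-layer x⊑y) ⟩
        kronecker FinP._≟_ x (top y) - kronecker FinP._≟_ x (top y)
          ≡⟨ ℤP.+-inverseʳ (kronecker FinP._≟_ x (top y)) ⟩
        0ℤ ∎

      -- C satisfies the defining recursion of the Möbius function of 𝒟_P.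
      C-isMobius : IsMobius (doubleElems n) _⊑_ C
      C-isMobius = (λ {a} _ → C-diag a) , (λ {a} {b} _ _ → C-zero a b) ,
        λ {a} {b} _ _ a⊑b a≢b → subst (SumOver (𝒟.Interval a b) (C a) (doubleElems n))
          (C-interval-sum a b a⊑b a≢b) (sumL⇒SumOver (𝒟.interval? a b) (doubleElems n))
        where
        C-diag : ∀ a → C a a ≡ 1ℤ
        C-diag (x , e) = trans (C-same e x x) (proj₁ Mμ (∈-elems x))

        C-zero : ∀ a b → ¬ (a ⊑ b) → C a b ≡ 0ℤ
        C-zero (x , S.-) (y , S.-) a⋢b = proj₁ (proj₂ Mμ) (∈-elems x) (∈-elems y) (a⋢b ∘ ⊑-same⇐)
        C-zero (x , S.+) (y , S.+) a⋢b = proj₁ (proj₂ Mμ) (∈-elems x) (∈-elems y) (a⋢b ∘ ⊑-same⇐)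
        C-zero (x , S.+) (y , S.-) _   = refl
        C-zero (x , S.-) (y , S.+) a⋢b = restrict-zero (crossing? x) _ λ (εx , εy) →
          cong -_ (proj₁ (proj₂ Mμ⁺) (∈-plusElems εx) (∈-plusElems (λ-into y εy)) λ x≤λy →
            a⋢b (inj₂ (refl , refl , λ′ y , λ-into y εy , x≤λy , subst (_≤ y) (sym (δλ y εy)) ≤-refl)))

        C-interval-sum : ∀ a b → a ⊑ b → a ≢ b → 𝒟.intervalSum (C a) a b ≡ 0ℤ
        C-interval-sum (x , e) (y , _) (inj₁ (refl , x≤y)) a≢b = same-interval-sum e x≤y (a≢b ∘ cong (_, e))
        C-interval-sum (x , _) (y , _) x⊑y@(inj₂ (refl , refl , _)) _ = mixed-interval-sum x⊑y

      -- μ̂ = C, by uniqueness of the Möbius function of 𝒟_P.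
      μ̂≡C : ∀ {μ̂} → IsMobius (doubleElems n) _⊑_ μ̂ → ∀ a b → μ̂ a b ≡ C a b
      μ̂≡C Mμ̂ a b = 𝒟.mobius-unique ⊏-wellFounded Mμ̂ C-isMobius (∈-doubleElems a) (∈-doubleElems b)

-- 5. The theorem

-- Double-negation choice over a finite index set.
¬¬-finite-choice : ∀ {m} {P : Fin m → Set} → (∀ i → ¬ ¬ P i) → ¬ ¬ (∀ i → P i)
¬¬-finite-choice {zero}          _   k = k λ ()
¬¬-finite-choice {suc m} {P} ¬¬P k = ¬¬P zero λ P0 →
  ¬¬-finite-choice {P = P ∘ suc} (¬¬P ∘ suc) λ Psuc → k λ { zero → P0 ; (suc i) → Psuc i }

-- Every relation on a finite set is decidable, up to double negation.
¬¬-decidable : ∀ {m} (R : Fin m → Fin m → Set) → ¬ ¬ B.Decidable R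
¬¬-decidable R = ¬¬-finite-choice λ x → ¬¬-finite-choice λ y → ¬¬-excluded-middle

corollary2p6 : (n : ℕ) (_≤_ : Fin n → Fin n → Set) → IsFinPoset n _≤_ →
    (L : LayerStructure n _≤_) → PropertyM L →
    (μ μ⁺ : Fin n → Fin n → ℤ) (μ̂ : Fin n × Sign → Fin n × Sign → ℤ) →
    IsMobius (elems n) _≤_ μ →
    IsMobius (plusElems L) _≤_ μ⁺ →
    IsMobius (doubleElems n) (_⪯_ L) μ̂ →
    ∀ x₀ x₁ e₀ e₁ →
      ((e₀ ≡ e₁) → μ̂ (x₀ , e₀) (x₁ , e₁) ≡ μ x₀ x₁) ×
      ((e₀ ≡ S.-) → (e₁ ≡ S.+) → (LayerStructure.ε L x₀ ≡ S.+) →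
         (LayerStructure.ε L x₁ ≡ S.-) →
         μ̂ (x₀ , e₀) (x₁ , e₁) ≡ - μ⁺ x₀ (LayerStructure.λ′ L x₁)) ×
      (¬ (e₀ ≡ e₁) →
         ¬ ((e₀ ≡ S.-) × (e₁ ≡ S.+) × (LayerStructure.ε L x₀ ≡ S.+) ×
              (LayerStructure.ε L x₁ ≡ S.-)) →
         μ̂ (x₀ , e₀) (x₁ , e₁) ≡ 0ℤ)
corollary2p6 n _≤_ po L M μ μ⁺ μ̂ Mμ Mμ⁺ Mμ̂ x₀ x₁ e₀ e₁ =
    (λ { refl → trans μ̂≡C (C-same e₀ x₀ x₁) })
  , (λ { refl refl εx₀ εx₁ → trans μ̂≡C (C-crossing (εx₀ , εx₁)) })
  , (λ e₀≢e₁ ¬mixed → trans μ̂≡C (C-vanish e₀≢e₁ ¬mixed))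
  where
  open Double po L M
  open Candidate μ μ⁺
  -- μ̂ = C is proved assuming ≤ decidable; an equation in ℤ is stable under
  -- double negation, so the assumption may be discharged by ¬¬-decidable.
  μ̂≡C : μ̂ (x₀ , e₀) (x₁ , e₁) ≡ C (x₀ , e₀) (x₁ , e₁)
  μ̂≡C = decidable-stable (μ̂ (x₀ , e₀) (x₁ , e₁) ℤ≟ C (x₀ , e₀) (x₁ , e₁)) λ μ̂≢C →
    ¬¬-decidable _≤_ λ _≤?_ → μ̂≢C (Decided.μ̂≡C _≤?_ Mμ Mμ⁺ Mμ̂ (x₀ , e₀) (x₁ , e₁))
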